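{- Let $p \neq 3$ be a prime. Then $p$ can be represented as $p = a^2+ab+b^2$ with integers $a \ge b \ge 0$ if and only if $p$ is of the form $6k+1$ for some integer $k$; moreover, when such a representation exists, it is unique, i.e. there is exactly one pair $(a,b)$ of integers with $a \ge b \ge 0$ and $p = a^2+ab+b^2$.
   Context: Two representations $a^2+ab+b^2$ and $c^2+cd+d^2$ (with $a\ge b\ge 0$ and $c\ge d\ge 0$ integers) are regarded as distinct if $a \ne c$ or $b \ne d$. -}

module Defs where

open import Data.Integer using (ℤ; +_; 0ℤ; _+_; _*_; _^_; _≥_)
open import Data.Nat using (ℕ)
open import Data.Product using (_×_; _,_)
open import Relation.Binary.PropositionalEquality using (_≡_)

IsRepresentation : ℕ → ℤ × ℤ → Set
IsRepresentation n (a , b) = a ≥ b × b ≥ 0ℤ × + n ≡ a ^ 2 + a * b + b ^ 2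

module Submission where

-- If p ≡ 1 (mod 6), the map x ↦ −1/(x + 1) acts on the p − 2 residues other
-- than 0 and −1 with order 3; as 3 ∤ p − 2 it has a fixed point, that is, p
-- divides x² + x + 1 for some x.  The form (p, 2x + 1, (x² + x + 1)/p) has
-- discriminant −3, and reducing it to (1, 1, 1) gives the representation.
-- With N(a,b) = a² + ab + b², uniqueness follows from
--   N(a,b) d² − N(c,d) b² = (ad − bc)(ad + bc + bd)
-- together with the multiplicativity of N, which bounds the two factors.

open import Defs
open import Data.Nat using (ℕ)
open import Data.Nat.Primality using (Prime)
open import Data.Product using (∃; ∃!; _×_)
open import Function.Bundles using (_⇔_)
open import Relation.Binary.PropositionalEquality using (_≡_; _≢_)

module _ where

  open import Data.Nat.Properties
  open import Algebra.Properties.CommutativeMonoid.Sum +-0-commutativeMonoid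
    using (sum; sum-permute; ∑-distrib-+; sum-cong-≗)
  open import Data.Bool using (true; false; not; _∧_; if_then_else_; T)
  open import Data.Fin using (Fin; toℕ; fromℕ<)
  open import Data.Fin.Permutation using (permutation)
  open import Data.Fin.Properties as Fin using (toℕ<n; toℕ-fromℕ<; toℕ-injective; any?; all?)
  open import Data.Nat
  open import Data.Nat.Coprimality using (prime⇒coprime; coprime-Bézout)
  open import Data.Nat.Divisibility
  open import Data.Nat.DivMod
  open import Data.Nat.GCD using (module Bézout)
  open import Data.Nat.Induction using (<-rec)
  open import Data.Nat.Primality
  open import Data.Nat.Tactic.RingSolver using (solve-∀)
  open import Data.Product using (Σ; _,_; proj₁; proj₂; map)
  open import Data.Sum using (_⊎_; inj₁; inj₂)
  open import Function using (_∘_)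
  open import Relation.Binary.Definitions using (tri<; tri≈; tri>)
  open import Relation.Binary.PropositionalEquality
  open import Relation.Nullary
  open import Relation.Nullary.Decidable using (¬?; _×-dec_; from-yes)

  -- The norm of the Eisenstein integer a - bω, where ω is a primitive cube root of unity.
  norm : ℕ → ℕ → ℕ
  norm a b = a * a + a * b + b * b

  -- Permutations of order three

  <ᵇ-flip : ∀ {a b} → a ≢ b → (b <ᵇ a) ≡ not (a <ᵇ b)
  <ᵇ-flip {zero}  {zero}  a≢b = contradiction refl a≢b
  <ᵇ-flip {zero}  {suc b} a≢b = refl
  <ᵇ-flip {suc a} {zero}  a≢b = refl
  <ᵇ-flip {suc a} {suc b} a≢b = <ᵇ-flip (a≢b ∘ cong suc)

  <ᵇ-true⇒< : ∀ a b → (a <ᵇ b) ≡ true → a < b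
  <ᵇ-true⇒< a b eq = <ᵇ⇒< a b (subst T (sym eq) _)

  isLeast : ℕ → ℕ → ℕ → ℕ
  isLeast a b c = if (a <ᵇ b) ∧ (a <ᵇ c) then 1 else 0

  -- The comparisons a < b, b < c, c < a determine the other three. If they all agree, transitivity
  -- gives a cycle; in each mixed pattern exactly one summand is 1.
  isLeast-cyclic-sum : ∀ {a b c} → a ≢ b → b ≢ c → c ≢ a →
    isLeast a b c + (isLeast b c a + isLeast c a b) ≡ 1
  isLeast-cyclic-sum {a} {b} {c} a≢b b≢c c≢a
    rewrite <ᵇ-flip a≢b | <ᵇ-flip b≢c | <ᵇ-flip c≢a
    with a <ᵇ b in ab | b <ᵇ c in bc | c <ᵇ a in ca
  ... | true  | true  | true  = contradiction (<-trans (<ᵇ-true⇒< a b ab) (<ᵇ-true⇒< b c bc))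
                                              (<-asym (<ᵇ-true⇒< c a ca))
  ... | true  | true  | false = refl
  ... | true  | false | true  = refl
  ... | true  | false | false = refl
  ... | false | true  | true  = refl
  ... | false | true  | false = refl
  ... | false | false | true  = refl
  ... | false | false | false = contradiction (<-trans (flipped b≢c bc) (flipped a≢b ab))
                                              (<-asym (flipped c≢a ca))
    where
    flipped : ∀ {m n} → m ≢ n → (m <ᵇ n) ≡ false → n < m
    flipped {m} {n} m≢n eq = <ᵇ-true⇒< n m (trans (<ᵇ-flip m≢n) (cong not eq))

  sum-const-1 : ∀ n → sum {n} (λ _ → 1) ≡ n
  sum-const-1 zero    = refl
  sum-const-1 (suc n) = cong suc (sum-const-1 n)

  -- Count one least element in each orbit.
  order3-fixedPointFree⇒3∣n : ∀ {n} (f : Fin n → Fin n) →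
    (∀ i → f (f (f i)) ≡ i) → (∀ i → f i ≢ i) → 3 ∣ n
  order3-fixedPointFree⇒3∣n {n} f f³ f≢ = divides (sum g) (begin
    n                                           ≡⟨ sum-const-1 n ⟨
    sum {n} (λ _ → 1)                           ≡⟨ sum-cong-≗ (sym ∘ pointwise) ⟩
    sum (λ i → g i + (g (f i) + g (f (f i))))   ≡⟨ ∑-distrib-+ g _ ⟩
    sum g + sum (λ i → g (f i) + g (f (f i)))   ≡⟨ cong (sum g +_) (∑-distrib-+ (g ∘ f) _) ⟩
    sum g + (sum (g ∘ f) + sum (g ∘ f ∘ f))     ≡⟨ cong₂ (λ s t → sum g + (s + t)) (sym (sum-permute g π))
                                                     (sym (trans (sum-permute g π) (sum-permute (g ∘ f) π))) ⟩
    sum g + (sum g + sum g)                     ≡⟨ triple (sum g) ⟩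
    sum g * 3                                   ∎)
    where
    open ≡-Reasoning
    -- `f ∘ f` inverts `f`, so reindexing along `f` preserves the sum of `g`.
    π = permutation f (f ∘ f) f³ f³
    g : Fin n → ℕ
    g i = isLeast (toℕ i) (toℕ (f i)) (toℕ (f (f i)))
    triple : ∀ s → s + (s + s) ≡ s * 3
    triple = solve-∀
    distinct : ∀ i → toℕ i ≢ toℕ (f i)
    distinct i eq = f≢ i (sym (toℕ-injective eq))
    pointwise : ∀ i → g i + (g (f i) + g (f (f i))) ≡ 1
    pointwise i with eq ← distinct (f (f i)) rewrite f³ i =
      isLeast-cyclic-sum (distinct i) (distinct (f i)) eq

  -- Primitive cube roots of unity

  -- R p x y says y ≡ −1/(x + 1) modulo p.
  R : ℕ → ℕ → ℕ → Set
  R p x y = p ∣ 1 + suc x * y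

  -- The order 3 of x ↦ -1/(x + 1), stated without division: in `identity` the terms for `x , y` and
  -- `y , z` are multiples of p, hence so is the one for `z , x`.
  R-cyclic : ∀ {p} x y z → R p x y → R p y z → R p z x
  R-cyclic {p} x y z xy yz = ∣m+n∣m⇒∣n
    (subst (p ∣_) (identity x y z) (∣n⇒∣m*n (1 + x) yz)) (∣n⇒∣m*n z xy)
    where
    identity : ∀ x y z → (1 + x) * (1 + (1 + y) * z) ≡ z * (1 + (1 + x) * y) + (1 + (1 + z) * x)
    identity = solve-∀

  -- Both sides of `identity` expand to y + z + (1 + x) y z, so y ≡ z modulo p, and the bounds turn
  -- this congruence into equality.
  R-functional : ∀ {p} x {y z} → R p x y → R p x z → y < p → z < p → y ≡ z
  R-functional {p} x {y} {z} (divides k xy) (divides l xz) y<p z<p = begin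
    y                                 ≡⟨ m<n⇒m%n≡m y<p ⟨
    y % p                             ≡⟨ [m+kn]%n≡m%n y (z * k) p ⟨
    (y + z * k * p) % p               ≡⟨ cong (_% p) rearranged ⟩
    (z + y * l * p) % p               ≡⟨ [m+kn]%n≡m%n z (y * l) p ⟩
    z % p                             ≡⟨ m<n⇒m%n≡m z<p ⟩
    z                                 ∎
    where
    open ≡-Reasoning
    instance _ = >-nonZero (m<n⇒0<n y<p)
    identity : ∀ x y z → y + z * (1 + (1 + x) * y) ≡ z + y * (1 + (1 + x) * z)
    identity = solve-∀
    rearranged : y + z * k * p ≡ z + y * l * p
    rearranged = begin
      y + z * k * p              ≡⟨ cong (y +_) (*-assoc z k p) ⟩
      y + z * (k * p)            ≡⟨ cong (λ t → y + z * t) xy ⟨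
      y + z * (1 + suc x * y)    ≡⟨ identity x y z ⟩
      z + y * (1 + suc x * z)    ≡⟨ cong (λ t → z + y * t) xz ⟩
      z + y * (l * p)            ≡⟨ cong (z +_) (*-assoc y l p) ⟨
      z + y * l * p              ∎

  R-exists : ∀ {q} x → Prime (suc q) → suc x < suc q → ∃ (R (suc q) x)
  R-exists {q} x pp x<q with coprime-Bézout (prime⇒coprime pp x<q)
  ... | Bézout.+- u v eq = v , divides u (trans (cong suc (*-comm (suc x) v)) eq)
  -- Here `v` inverts `suc x`, whereas the negative of an inverse is wanted; `q` is -1 modulo
  -- `suc q`.
  ... | Bézout.-+ u v eq = v * q , divides (1 + u * q) (begin
    1 + suc x * (v * q)          ≡⟨ cong suc (regroup (suc x) v q) ⟩
    1 + v * suc x * q            ≡⟨ cong (λ t → 1 + t * q) eq ⟨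
    1 + (1 + u * (1 + q)) * q    ≡⟨ identity u q ⟩
    (1 + u * q) * (1 + q)        ∎)
    where
    open ≡-Reasoning
    regroup : ∀ s v q → s * (v * q) ≡ v * s * q
    regroup = solve-∀
    identity : ∀ u q → 1 + (1 + u * (1 + q)) * q ≡ (1 + u * q) * (1 + q)
    identity = solve-∀

  R-% : ∀ {p} .{{_ : NonZero p}} x y → R p x y → R p x (y % p)
  R-% {p} x y xy = ∣m+n∣n⇒∣m (subst (p ∣_) split xy) (n∣m*n (suc x * (y / p)))
    where
    ∣m+n∣n⇒∣m : ∀ {d m n} → d ∣ m + n → d ∣ n → d ∣ m
    ∣m+n∣n⇒∣m {d} {m} {n} d∣ = ∣m+n∣m⇒∣n (subst (d ∣_) (+-comm m n) d∣)
    identity : ∀ x r k p → 1 + (1 + x) * (r + k * p) ≡ 1 + (1 + x) * r + (1 + x) * k * p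
    identity = solve-∀
    split : 1 + suc x * y ≡ 1 + suc x * (y % p) + suc x * (y / p) * p
    split = trans (cong (λ t → 1 + suc x * t) (m≡m%n+[m/n]*n y p)) (identity x (y % p) (y / p) p)

  -- `Fin n` encodes the residues 1, ..., n modulo 2 + n, leaving out 0 and -1. Neither of these is
  -- a value: y = 0 would make 2 + n divide 1, and y = n + 1 would make it divide x, where 0 < x < 2
  -- + n.
  R-range : ∀ {n} (i : Fin n) y → R (2 + n) (suc (toℕ i)) y → y < 2 + n →
    Σ (Fin n) λ j → R (2 + n) (suc (toℕ i)) (suc (toℕ j))
  R-range {n} i zero xy _ =
    contradiction (∣1⇒≡1 (subst (λ t → 2 + n ∣ 1 + t) (*-zeroʳ (2 + toℕ i)) xy)) λ ()
  R-range {n} i (suc y) xy y<p with y ≟ n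
  ... | no  y≢n  = fromℕ< y<n , subst (R (2 + n) (suc (toℕ i)) ∘ suc) (sym (toℕ-fromℕ< y<n)) xy
    where
    y<n : y < n
    y<n = ≤∧≢⇒< (s≤s⁻¹ (s≤s⁻¹ y<p)) y≢n
  ... | yes refl = contradiction (∣⇒≤ p∣x) (<⇒≱ (s≤s (m≤n⇒m≤1+n (toℕ<n i))))
    where
    x = suc (toℕ i)
    identity : ∀ x n → x * (2 + n) + (2 + n) ≡ 1 + (1 + x) * (1 + n) + x
    identity = solve-∀
    p∣x : 2 + n ∣ x
    p∣x = ∣m+n∣m⇒∣n (subst (2 + n ∣_) (identity x n) (∣m∣n⇒∣m+n (n∣m*n x) ∣-refl)) xy

  R-next : ∀ {n} → Prime (2 + n) → (i : Fin n) →
    Σ (Fin n) λ j → R (2 + n) (suc (toℕ i)) (suc (toℕ j))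
  R-next {n} pp i = let y , xy = R-exists (suc (toℕ i)) pp (s≤s (s≤s (toℕ<n i))) in
    R-range i (y % (2 + n)) (R-% (suc (toℕ i)) y xy) (m%n<n y (2 + n))

  -- `R-cyclic` and `R-functional` force f³ = id, so the orbit count yields a fixed point, which is
  -- a root of x² + x + 1 modulo 2 + n.
  R-fixedPoint : ∀ {n} (f : Fin n → Fin n) → 3 ∤ n →
    (∀ i → R (2 + n) (suc (toℕ i)) (suc (toℕ (f i)))) → ∃ λ x → R (2 + n) x x
  R-fixedPoint {n} f 3∤n step with any? (λ i → f i Fin.≟ i)
  ... | yes (i , fi≡i) = val i , subst (R (2 + n) (val i) ∘ val) fi≡i (step i)
    where
    val : Fin n → ℕ
    val i = suc (toℕ i)
  ... | no  no-fix = contradiction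
    (order3-fixedPointFree⇒3∣n f f³ (λ i eq → no-fix (i , eq))) 3∤n
    where
    val : Fin n → ℕ
    val i = suc (toℕ i)
    val<p : ∀ i → val i < 2 + n
    val<p i = s≤s (m≤n⇒m≤1+n (toℕ<n i))
    f³ : ∀ i → f (f (f i)) ≡ i
    f³ i = toℕ-injective (suc-injective (R-functional (val (f (f i))) (step (f (f i)))
      (R-cyclic (val i) (val (f i)) (val (f (f i))) (step i) (step (f i)))
      (val<p (f (f (f i)))) (val<p i)))

  cube-root-of-unity : ∀ {n} → Prime (2 + n) → 3 ∤ n → ∃ λ x → R (2 + n) x x
  cube-root-of-unity pp 3∤n = R-fixedPoint (proj₁ ∘ R-next pp) 3∤n (proj₂ ∘ R-next pp)

  -- Reduction of forms of discriminant −3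

  -- A u² + (2x + 1) u v + C v² is the pull-back of the norm form along the
  -- linear map with columns (a , b) and (c , d).
  Reduced : ℕ → ℕ → ℕ → Set
  Reduced x A C = ∃ λ a → ∃ λ b → ∃ λ c → ∃ λ d →
    A ≡ norm a b × C ≡ norm c d × 1 + 2 * x ≡ 2 * (a * c) + a * d + b * c + 2 * (b * d)

  Reduced-swap : ∀ {x A C} → Reduced x A C → Reduced x C A
  Reduced-swap (a , b , c , d , eA , eC , ex) =
    c , d , a , b , eC , eA , trans ex (identity a b c d)
    where
    identity : ∀ a b c d → 2 * (a * c) + a * d + b * c + 2 * (b * d)
                         ≡ 2 * (c * a) + c * b + d * a + 2 * (d * b)
    identity = solve-∀

  -- The substitution v ↦ u + v in the form, which adds the second column of the linear map to the
  -- first.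
  Reduced-shift : ∀ {x A C} → Reduced x A C → Reduced (x + C) (A + (1 + 2 * x) + C) C
  Reduced-shift {x} {A} {C} (a , b , c , d , refl , refl , ex) =
    a + c , b + d , c , d , trans (cong (λ t → A + t + C) ex) (identity₁ a b c d) , refl ,
    (begin
      1 + 2 * (x + C)                                            ≡⟨ distr x C ⟩
      1 + 2 * x + 2 * C                                          ≡⟨ cong (_+ 2 * C) ex ⟩
      2 * (a * c) + a * d + b * c + 2 * (b * d) + 2 * C          ≡⟨ identity₂ a b c d ⟩
      2 * ((a + c) * c) + (a + c) * d + (b + d) * c + 2 * ((b + d) * d) ∎)
    where
    open ≡-Reasoning
    distr : ∀ x C → 1 + 2 * (x + C) ≡ 1 + 2 * x + 2 * C
    distr = solve-∀
    identity₁ : ∀ a b c d →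
      a * a + a * b + b * b + (2 * (a * c) + a * d + b * c + 2 * (b * d)) + (c * c + c * d + d * d)
      ≡ (a + c) * (a + c) + (a + c) * (b + d) + (b + d) * (b + d)
    identity₁ = solve-∀
    identity₂ : ∀ a b c d →
      2 * (a * c) + a * d + b * c + 2 * (b * d) + 2 * (c * c + c * d + d * d)
      ≡ 2 * ((a + c) * c) + (a + c) * d + (b + d) * c + 2 * ((b + d) * d)
    identity₂ = solve-∀

  -- The equation says that the discriminant (2x + 1)² - 4AC is -3.
  Reducible : ℕ → Set
  Reducible x = ∀ A C → A * C ≡ 1 + suc x * x → Reduced x A C

  -- Undoes a shift: C also divides y² + y + 1, and the quotient `A′` is the first coefficient of
  -- the form with the smaller middle coefficient 2y + 1.
  reduce-step : ∀ {y} A C → .{{NonZero C}} → Reducible y →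
    A * C ≡ 1 + suc (y + C) * (y + C) → Reduced (y + C) A C
  reduce-step {y} A C rec eq = subst (λ t → Reduced (y + C) t C) (sym A≡)
    (Reduced-shift {y} {A′} {C} (rec A′ C (sym (_∣_.equality C∣))))
    where
    open ≡-Reasoning
    identity : ∀ y C → 1 + (1 + (y + C)) * (y + C) ≡ (1 + 2 * y + C) * C + (1 + (1 + y) * y)
    identity = solve-∀
    regroup : ∀ A y C → (1 + 2 * y + C) * C + A * C ≡ (A + (1 + 2 * y) + C) * C
    regroup = solve-∀
    C∣ : C ∣ 1 + suc y * y
    C∣ = ∣m+n∣m⇒∣n (divides A (trans (sym (identity y C)) (sym eq))) (n∣m*n (1 + 2 * y + C))
    A′ = quotient C∣
    A≡ : A ≡ A′ + (1 + 2 * y) + C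
    A≡ = *-cancelʳ-≡ A _ C (begin
      A * C                                  ≡⟨ eq ⟩
      1 + suc (y + C) * (y + C)              ≡⟨ identity y C ⟩
      (1 + 2 * y + C) * C + (1 + suc y * y)  ≡⟨ cong ((1 + 2 * y + C) * C +_) (_∣_.equality C∣) ⟩
      (1 + 2 * y + C) * C + A′ * C           ≡⟨ regroup A′ y C ⟩
      (A′ + (1 + 2 * y) + C) * C             ∎)

  reduce-rec : ∀ {x} A C → (∀ {y} → y < x → Reducible y) → C ≤ x →
    A * C ≡ 1 + suc x * x → Reduced x A C
  reduce-rec     A zero      rec C≤x eq = contradiction (trans (sym eq) (*-zeroʳ A)) λ ()
  reduce-rec {x} A C@(suc _) rec C≤x eq = subst (λ t → Reduced t A C) x∸C+C≡x
    (reduce-step {x ∸ C} A C (rec (∸-monoʳ-< z<s C≤x))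
      (trans eq (cong (λ t → 1 + suc t * t) (sym x∸C+C≡x))))
    where
    x∸C+C≡x : x ∸ C + C ≡ x
    x∸C+C≡x = m∸n+n≡m C≤x

  -- Strong induction on x. If A or C is at most x, it is subtracted from x. Otherwise A C ≥ (x +
  -- 1)², which exceeds x² + x + 1 unless x = 0.
  reduce : ∀ x → Reducible x
  reduce = <-rec Reducible go
    where
    go : ∀ x → (∀ {y} → y < x → Reducible y) → Reducible x
    go x rec A C eq with C ≤? x | A ≤? x
    ... | yes C≤x | _       = reduce-rec {x} A C rec C≤x eq
    ... | no  _   | yes A≤x = Reduced-swap {x} {C} {A} (reduce-rec {x} C A rec A≤x (trans (*-comm C A) eq))
    -- Now A C = 1, so the form is the norm form itself and the identity map serves.
    go zero rec A C eq | no _ | no _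
      rewrite m*n≡1⇒m≡1 A C eq | m*n≡1⇒n≡1 A C eq = 1 , 0 , 0 , 1 , refl , refl , refl
    go x@(suc _) rec A C eq | no C≰x | no A≰x =
      contradiction (*-mono-≤ (≰⇒> A≰x) (≰⇒> C≰x)) (<⇒≱ (begin-strict
        A * C              ≡⟨ eq ⟩
        1 + suc x * x      <⟨ +-monoˡ-< (suc x * x) (s<s z<s) ⟩
        suc x + suc x * x  ≡⟨ *-suc (suc x) x ⟨
        suc x * suc x      ∎))
      where open ≤-Reasoning

  -- With p placed as the last coefficient, the second column of the reducing map represents p.
  cube-root-of-unity⇒norm : ∀ {p} → (∃ λ x → R p x x) → ∃ λ a → ∃ λ b → p ≡ norm a b
  cube-root-of-unity⇒norm {p} (x , divides A eq) with reduce x A p (sym eq)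
  ... | _ , _ , c , d , _ , p≡norm , _ = c , d , p≡norm

  prime≡1[6]⇒norm : ∀ {p} m → Prime p → p ≡ 6 * m + 1 → ∃ λ a → ∃ λ b → p ≡ norm a b
  prime≡1[6]⇒norm {suc (suc n)} m pp eq = cube-root-of-unity⇒norm (cube-root-of-unity pp 3∤n)
    where
    identity : ∀ m → 6 * m ≡ 2 * m * 3
    identity = solve-∀
    n+1≡ : n + 1 ≡ 2 * m * 3
    n+1≡ = trans (+-comm n 1) (trans (suc-injective (trans eq (+-comm (6 * m) 1))) (identity m))
    -- Since n + 2 = p = 6m + 1, the number n + 1 is a multiple of 3.
    3∤n : 3 ∤ n
    3∤n 3∣n = contradiction (∣1⇒≡1 (∣m+n∣m⇒∣n (divides (2 * m) n+1≡) 3∣n)) λ ()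

  norm-comm : ∀ a b → norm a b ≡ norm b a
  norm-comm = identity
    where
    identity : ∀ a b → a * a + a * b + b * b ≡ b * b + b * a + a * a
    identity = solve-∀

  ∃-norm⇒∃-ordered : ∀ {p} → (∃ λ a → ∃ λ b → p ≡ norm a b) →
    ∃ λ a → ∃ λ b → b ≤ a × p ≡ norm a b
  ∃-norm⇒∃-ordered (a , b , eq) with ≤-total b a
  ... | inj₁ b≤a = a , b , b≤a , eq
  ... | inj₂ a≤b = b , a , a≤b , trans eq (norm-comm a b)

  -- Residues of primes

  prime∣prime⇒≡ : ∀ {p q} → Prime p → Prime q → q ∣ p → p ≡ q
  prime∣prime⇒≡ pp pq q∣p with prime⇒irreducible pp q∣p
  ... | inj₁ refl = contradiction pq ¬prime[1]
  ... | inj₂ refl = refl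

  3∣prime⇒≡3 : ∀ {p} → Prime p → 3 ∣ p → p ≡ 3
  3∣prime⇒≡3 pp = prime∣prime⇒≡ pp (from-yes (prime? 3))

  norm-% : ∀ a b n .{{_ : NonZero n}} → norm a b % n ≡ norm (a % n) (b % n) % n
  norm-% a b n = begin
    norm a b % n  ≡⟨ cong (_% n) (trans (cong₂ norm (m≡m%n+[m/n]*n a n) (m≡m%n+[m/n]*n b n))
                                        (identity (a % n) (a / n) (b % n) (b / n) n)) ⟩
    (norm r s + K * n) % n  ≡⟨ [m+kn]%n≡m%n (norm r s) K n ⟩
    norm r s % n  ∎
    where
    open ≡-Reasoning
    r = a % n
    s = b % n
    k = a / n
    l = b / n
    K = 2 * r * k + k * k * n + r * l + k * s + k * l * n + 2 * s * l + l * l * n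
    identity : ∀ r k s l n →
      (r + k * n) * (r + k * n) + (r + k * n) * (s + l * n) + (s + l * n) * (s + l * n)
      ≡ r * r + r * s + s * s
        + (2 * r * k + k * k * n + r * l + k * s + k * l * n + 2 * s * l + l * l * n) * n
    identity = solve-∀

  -- Modulo 3 the norm is (a - b)², hence never 2. The proof decides all 36 pairs of residues modulo
  -- 6.
  norm%6≢2,5 : ∀ a b → norm a b % 6 ≢ 2 × norm a b % 6 ≢ 5
  norm%6≢2,5 a b = subst (λ t → t ≢ 2 × t ≢ 5) (sym residue)
    (residues (fromℕ< (m%n<n a 6)) (fromℕ< (m%n<n b 6)))
    where
    residues : ∀ (i j : Fin 6) → norm (toℕ i) (toℕ j) % 6 ≢ 2 × norm (toℕ i) (toℕ j) % 6 ≢ 5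
    residues = from-yes (all? λ (i : Fin 6) → all? λ (j : Fin 6) →
      ¬? (norm (toℕ i) (toℕ j) % 6 ≟ 2) ×-dec ¬? (norm (toℕ i) (toℕ j) % 6 ≟ 5))
    residue : norm a b % 6 ≡ norm (toℕ (fromℕ< (m%n<n a 6))) (toℕ (fromℕ< (m%n<n b 6))) % 6
    residue = trans (norm-% a b 6) (sym (cong₂ (λ r s → norm r s % 6)
      (toℕ-fromℕ< (m%n<n a 6)) (toℕ-fromℕ< (m%n<n b 6))))

  ∣%6⇒∣ : ∀ {d r} p → d ∣ 6 → p % 6 ≡ r → d ∣ r → d ∣ p
  ∣%6⇒∣ {d} p d∣6 refl d∣r = subst (d ∣_) (sym (m≡m%n+[m/n]*n p 6))
    (∣m∣n⇒∣m+n d∣r (∣n⇒∣m*n (p / 6) d∣6))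

  -- Residues 0 and 3 would make 3 divide p, residue 4 would force p = 2, whose residue is 2, and
  -- the norm never takes the residues 2 and 5.
  prime-norm⇒≡1[6] : ∀ {p} → Prime p → p ≢ 3 → (∃ λ a → ∃ λ b → p ≡ norm a b) →
    ∃ λ m → p ≡ 6 * m + 1
  prime-norm⇒≡1[6] {p} pp p≢3 (a , b , refl) =
    p / 6 , trans (m≡m%n+[m/n]*n p 6) (trans (cong (_+ p / 6 * 6) p%6≡1)
      (trans (+-comm 1 _) (cong (_+ 1) (*-comm (p / 6) 6))))
    where
    3∤p : 3 ∤ p
    3∤p = p≢3 ∘ 3∣prime⇒≡3 pp
    p%6≡1 : p % 6 ≡ 1
    p%6≡1 with p % 6 in eq | m%n<n p 6
    ... | 0 | _ = contradiction (∣%6⇒∣ p (divides 2 refl) eq (3 ∣0)) 3∤p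
    ... | 1 | _ = refl
    ... | 2 | _ = contradiction eq (proj₁ (norm%6≢2,5 a b))
    ... | 3 | _ = contradiction (∣%6⇒∣ p (divides 2 refl) eq ∣-refl) 3∤p
    ... | 4 | _ = contradiction (trans (sym eq) (cong (_% 6) p≡2)) λ ()
      where
      p≡2 : p ≡ 2
      p≡2 = prime∣prime⇒≡ pp prime[2] (∣%6⇒∣ p (divides 3 refl) eq (divides 2 refl))
    ... | 5 | _ = contradiction eq (proj₂ (norm%6≢2,5 a b))
    ... | suc (suc (suc (suc (suc (suc _))))) | s≤s (s≤s (s≤s (s≤s (s≤s (s≤s ())))))

  -- Uniqueness

  m*m≡0⇒m≡0 : ∀ m → m * m ≡ 0 → m ≡ 0
  m*m≡0⇒m≡0 zero _ = refl

  m*m≡n*n⇒m≡n : ∀ m n → m * m ≡ n * n → m ≡ n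
  m*m≡n*n⇒m≡n m n eq with <-cmp m n
  ... | tri< m<n _ _ = contradiction eq (<⇒≢ (*-mono-< m<n m<n))
  ... | tri≈ _ m≡n _ = m≡n
  ... | tri> _ _ n<m = contradiction (sym eq) (<⇒≢ (*-mono-< n<m n<m))

  -- If m > 0 then p ≤ m, so m² alone already reaches p² and leaves no room for n².
  p²≡norm∧∣ : ∀ {p} n m → p * p ≡ norm n m → p ∣ m → n ≡ 0 ⊎ m ≡ 0
  p²≡norm∧∣     n zero      eq p∣m = inj₂ refl
  p²≡norm∧∣ {p} n m@(suc _) eq p∣m = inj₁ (m*m≡0⇒m≡0 n (m+n≡0⇒m≡0 (n * n) (n≤0⇒n≡0
    (+-cancelʳ-≤ (m * m) _ 0 (begin
      norm n m  ≡⟨ eq ⟨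
      p * p     ≤⟨ *-mono-≤ (∣⇒≤ p∣m) (∣⇒≤ p∣m) ⟩
      m * m     ∎)))))
    where open ≤-Reasoning

  -- The arguments stand for ac, ad, bc, bd. As free variables they allow a substitution for one of
  -- them; their relation W Z = X Y is then supplied separately.
  normProduct : ℕ → ℕ → ℕ → ℕ → ℕ
  normProduct W X Y Z =
    W * W + W * X + X * X + W * Y + W * Z + X * Z + Y * Y + Y * Z + Z * Z

  norm-*-expand : ∀ a b c d → norm a b * norm c d ≡
    normProduct (a * c) (a * d) (b * c) (b * d)
  norm-*-expand = identity
    where
    identity : ∀ a b c d → (a * a + a * b + b * b) * (c * c + c * d + d * d) ≡
      (a * c) * (a * c) + (a * c) * (a * d) + (a * d) * (a * d)
      + (a * c) * (b * c) + (a * c) * (b * d) + (a * d) * (b * d)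
      + (b * c) * (b * c) + (b * c) * (b * d) + (b * d) * (b * d)
    identity = solve-∀

  products-swap : ∀ a b c d → a * c * (b * d) ≡ a * d * (b * c)
  products-swap = solve-∀

  -- The next two lemmas evaluate N(ᾱ β) and N(α β) for α = a − bω, β = c − dω,
  -- with the coordinates that involve a subtraction given by their defining
  -- equation (ω is a primitive cube root of unity).
  norm-*-conj : ∀ a b c d h → a * d ≡ b * c + h →
    norm a b * norm c d ≡ norm (a * c + b * c + b * d) h
  norm-*-conj a b c d h ad≡ = trans (norm-*-expand a b c d)
    (collect (a * c) (a * d) (b * c) (b * d) h ad≡ (products-swap a b c d))
    where
    identity : ∀ W Y Z h →
      W * W + W * (Y + h) + (Y + h) * (Y + h) + W * Y + W * Z + (Y + h) * Z + Y * Y + Y * Z + Z * Z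
        + W * Z
      ≡ (W + Y + Z) * (W + Y + Z) + (W + Y + Z) * h + h * h + (Y + h) * Y
    identity = solve-∀
    -- As polynomials the two sides differ by X Y - W Z, so W Z is added to both and cancelled by
    -- means of W Z = X Y.
    collect : ∀ W X Y Z h → X ≡ Y + h → W * Z ≡ X * Y →
      normProduct W X Y Z ≡ norm (W + Y + Z) h
    collect W X Y Z h refl WZ≡XY = +-cancelʳ-≡ (W * Z) _ _
      (trans (identity W Y Z h) (cong (norm (W + Y + Z) h +_) (sym WZ≡XY)))

  norm-* : ∀ a b c d k → a * c ≡ b * d + k →
    norm a b * norm c d ≡ norm k (a * d + b * c + b * d)
  norm-* a b c d k ac≡ = trans (norm-*-expand a b c d)
    (collect (a * c) (a * d) (b * c) (b * d) k ac≡ (products-swap a b c d))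
    where
    identity : ∀ X Y Z k →
      (Z + k) * (Z + k) + (Z + k) * X + X * X + (Z + k) * Y + (Z + k) * Z + X * Z + Y * Y + Y * Z + Z * Z
        + 2 * (X * Y)
      ≡ k * k + k * (X + Y + Z) + (X + Y + Z) * (X + Y + Z) + 2 * ((Z + k) * Z)
    identity = solve-∀
    collect : ∀ W X Y Z k → W ≡ Z + k → W * Z ≡ X * Y →
      normProduct W X Y Z ≡ norm k (X + Y + Z)
    collect W X Y Z k refl WZ≡XY = +-cancelʳ-≡ (2 * (X * Y)) _ _
      (trans (identity X Y Z k) (cong (λ t → norm k (X + Y + Z) + 2 * t) WZ≡XY))

  -- The difference of the multiples d² N(a,b) and b² N(c,d) of p factors, because X² + XZ - Y² - YZ
  -- = (X - Y)(X + Y + Z) with X = ad, Y = bc, Z = bd.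
  p∣cross-product : ∀ {p a b c d h} → p ≡ norm a b → p ≡ norm c d → a * d ≡ b * c + h →
    p ∣ h * (a * d + b * c + b * d)
  p∣cross-product {p} {a} {b} {c} {d} {h} eab ecd ad≡ =
    ∣m+n∣m⇒∣n (divides (d * d) (sym (begin
      d * d * p                                             ≡⟨ cong (d * d *_) eab ⟩
      d * d * norm a b                                      ≡⟨ expandˡ a b d ⟩
      (a * d) * (a * d) + (a * d) * (b * d) + b * d * (b * d) ≡⟨ collect (a * d) (b * c) (b * d) h ad≡ ⟩
      (b * c) * (b * c) + (b * c) * (b * d) + b * d * (b * d) + h * S
                                                            ≡⟨ cong (_+ h * S) (expandʳ b c d) ⟨
      b * b * norm c d + h * S                              ≡⟨ cong (λ t → b * b * t + h * S) ecd ⟨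
      b * b * p + h * S                                     ∎))) (n∣m*n (b * b))
    where
    open ≡-Reasoning
    S = a * d + b * c + b * d
    expandˡ : ∀ a b d → d * d * (a * a + a * b + b * b)
      ≡ (a * d) * (a * d) + (a * d) * (b * d) + b * d * (b * d)
    expandˡ = solve-∀
    expandʳ : ∀ b c d → b * b * (c * c + c * d + d * d)
      ≡ (b * c) * (b * c) + (b * c) * (b * d) + b * d * (b * d)
    expandʳ = solve-∀
    factor : ∀ Y Z h → (Y + h) * (Y + h) + (Y + h) * Z + Z * Z
      ≡ Y * Y + Y * Z + Z * Z + h * (Y + h + Y + Z)
    factor = solve-∀
    collect : ∀ X Y Z h → X ≡ Y + h → X * X + X * Z + Z * Z ≡ Y * Y + Y * Z + Z * Z + h * (X + Y + Z)
    collect _ Y Z h refl = factor Y Z h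

  prime-norm⇒fst>0 : ∀ {a b} → Prime (norm a b) → b ≤ a → NonZero a
  prime-norm⇒fst>0 {zero}  pp z≤n = contradiction pp ¬prime[0]
  prime-norm⇒fst>0 {suc a} pp _   = _

  -- From ad = bc follows a² N(c,d) = c² N(a,b); cancelling p gives a² = c², and cancelling a in ad
  -- = bc then gives d = b.
  proportional⇒≡ : ∀ {p a b c d} → .{{NonZero p}} → .{{NonZero a}} → p ≡ norm a b → p ≡ norm c d →
    a * d ≡ b * c → a ≡ c × b ≡ d
  proportional⇒≡ {p} {a} {b} {c} {d} eab ecd ad≡bc = a≡c , sym d≡b
    where
    open ≡-Reasoning
    expandˡ : ∀ a b c → c * c * (a * a + a * b + b * b)
      ≡ a * c * (a * c) + a * c * (b * c) + b * c * (b * c)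
    expandˡ = solve-∀
    expandʳ : ∀ a c d → a * a * (c * c + c * d + d * d)
      ≡ a * c * (a * c) + a * c * (a * d) + a * d * (a * d)
    expandʳ = solve-∀
    a≡c : a ≡ c
    a≡c = m*m≡n*n⇒m≡n a c (*-cancelʳ-≡ (a * a) (c * c) p (begin
      a * a * p                                       ≡⟨ cong (a * a *_) ecd ⟩
      a * a * norm c d                                ≡⟨ expandʳ a c d ⟩
      a * c * (a * c) + a * c * (a * d) + a * d * (a * d)
        ≡⟨ cong (λ t → a * c * (a * c) + a * c * t + t * t) ad≡bc ⟩
      a * c * (a * c) + a * c * (b * c) + b * c * (b * c) ≡⟨ expandˡ a b c ⟨
      c * c * norm a b                                ≡⟨ cong (c * c *_) eab ⟨
      c * c * p                                       ∎))
    d≡b : d ≡ b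
    d≡b = *-cancelˡ-≡ d b a (trans ad≡bc (trans (cong (b *_) (sym a≡c)) (*-comm b a)))

  -- The prime p divides h = ad - bc or S = ad + bc + bd. Each of them is a coordinate in a
  -- representation of p² by the norm, so it or the other coordinate vanishes.
  unique-≤ : ∀ {p a b c d} → Prime p → p ≢ 3 → b ≤ a → d ≤ c →
    p ≡ norm a b → p ≡ norm c d → b * c ≤ a * d → a ≡ c × b ≡ d
  unique-≤ {p} {a} {b} {c} {d} pp p≢3 b≤a d≤c eab ecd bc≤ad =
    proportional⇒≡ eab ecd ad≡bc
    where
    instance
      _ = prime⇒nonZero pp
      a≢0 : NonZero a
      a≢0 = prime-norm⇒fst>0 (subst Prime eab pp) b≤a
      c≢0 : NonZero c
      c≢0 = prime-norm⇒fst>0 (subst Prime ecd pp) d≤c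
    h = a * d ∸ b * c
    k = a * c ∸ b * d
    S = a * d + b * c + b * d
    ad≡ : a * d ≡ b * c + h
    ad≡ = sym (m+[n∸m]≡n bc≤ad)
    ac≡ : a * c ≡ b * d + k
    ac≡ = sym (m+[n∸m]≡n (*-mono-≤ b≤a d≤c))
    p²≡ : p * p ≡ norm a b * norm c d
    p²≡ = cong₂ _*_ eab ecd
    ac≢0 : a * c ≢ 0
    ac≢0 = ≢-nonZero⁻¹ (a * c) {{m*n≢0 a c}}
    triple : ∀ a → a * a + a * a + a * a ≡ a * a * 3
    triple = solve-∀
    ad≡bc : a * d ≡ b * c
    ad≡bc with euclidsLemma h S pp (p∣cross-product {a = a} {b} {c} {d} {h} eab ecd ad≡)
    ... | inj₁ p∣h with p²≡norm∧∣ (a * c + b * c + b * d) h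
                         (trans p²≡ (norm-*-conj a b c d h ad≡)) p∣h
    -- The other coordinate contains ac > 0, so only h = 0 remains.
    ...   | inj₁ e≡0 = contradiction (m+n≡0⇒m≡0 (a * c) (m+n≡0⇒m≡0 (a * c + b * c) e≡0)) ac≢0
    ...   | inj₂ h≡0 = trans ad≡ (trans (cong (b * c +_) h≡0) (+-identityʳ _))
    ad≡bc | inj₂ p∣S with p²≡norm∧∣ k S (trans p²≡ (norm-* a b c d k ac≡)) p∣S
    ...   | inj₂ S≡0 = trans (m+n≡0⇒m≡0 (a * d) ad+bc≡0) (sym (m+n≡0⇒n≡0 (a * d) ad+bc≡0))
      where
      ad+bc≡0 : a * d + b * c ≡ 0
      ad+bc≡0 = m+n≡0⇒m≡0 _ S≡0
    -- Here ac = bd ≤ bc forces a = b, so p = 3a², contradicting p ≠ 3.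
    ...   | inj₁ k≡0 = contradiction (3∣prime⇒≡3 pp (divides (a * a)
                         (trans eab (trans (cong (norm a) b≡a) (triple a))))) p≢3
      where
      open ≤-Reasoning
      b≡a : b ≡ a
      b≡a = ≤-antisym b≤a (*-cancelʳ-≤ a b c (begin
        a * c      ≡⟨ ac≡ ⟩
        b * d + k  ≡⟨ cong (b * d +_) k≡0 ⟩
        b * d + 0  ≡⟨ +-identityʳ _ ⟩
        b * d      ≤⟨ *-monoʳ-≤ b d≤c ⟩
        b * c      ∎))

  unique : ∀ {p a b c d} → Prime p → p ≢ 3 → b ≤ a → d ≤ c →
    p ≡ norm a b → p ≡ norm c d → a ≡ c × b ≡ d
  unique {a = a} {b} {c} {d} pp p≢3 b≤a d≤c eab ecd with ≤-total (b * c) (a * d)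
  ... | inj₁ bc≤ad = unique-≤ pp p≢3 b≤a d≤c eab ecd bc≤ad
  ... | inj₂ ad≤bc = map sym sym (unique-≤ pp p≢3 d≤c b≤a ecd eab
                       (subst₂ _≤_ (*-comm a d) (*-comm b c) ad≤bc))

-- Transfer between natural numbers and integers

module _ where

  open import Data.Integer
  open import Data.Integer.Properties using (pos-*; *-identityʳ; +-injective; drop‿+≤+)
  open import Data.Nat as ℕ using (zero; suc; z≤n)
  open import Data.Product using (_,_)
  open import Relation.Binary.PropositionalEquality

  pos-norm : ∀ a b → + norm a b ≡ (+ a) ^ 2 + + a * + b + (+ b) ^ 2
  pos-norm a b = cong₂ _+_ (cong₂ _+_ (pos-sq a) (pos-* a b)) (pos-sq b)
    where
    pos-sq : ∀ m → + (m ℕ.* m) ≡ (+ m) ^ 2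
    pos-sq m = trans (pos-* m m) (cong (+ m *_) (sym (*-identityʳ (+ m))))

  representation⁺ : ∀ {p a b} → b ℕ.≤ a → p ≡ norm a b → IsRepresentation p (+ a , + b)
  representation⁺ {a = a} {b} b≤a eq = +≤+ b≤a , +≤+ z≤n , trans (cong +_ eq) (pos-norm a b)

  representation⁻ : ∀ {p x y} → IsRepresentation p (x , y) →
    ∃ λ a → ∃ λ b → (x ≡ + a × y ≡ + b) × b ℕ.≤ a × p ≡ norm a b
  -- The inequalities x ≥ y ≥ 0 exclude negative coordinates, so one clause suffices.
  representation⁻ {x = + a} {+ b} (b≤a , _ , eq) =
    a , b , (refl , refl) , drop‿+≤+ b≤a , +-injective (trans eq (sym (pos-norm a b)))

  pos-6*+1 : ∀ m → + (6 ℕ.* m ℕ.+ 1) ≡ + 6 * + m + 1ℤ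
  pos-6*+1 m = cong (_+ 1ℤ) (pos-* 6 m)

  pos≡6*+1⁻ : ∀ {p} k → + p ≡ + 6 * k + 1ℤ → ∃ λ m → p ≡ 6 ℕ.* m ℕ.+ 1
  pos≡6*+1⁻ (+ m)          eq = m , +-injective (trans eq (sym (pos-6*+1 m)))
  -- For negative `k` the value 6k + 1 is at most -5.
  pos≡6*+1⁻ -[1+ zero ]    ()
  pos≡6*+1⁻ -[1+ (suc _) ] ()

open import Data.Integer using (ℤ; +_; 1ℤ; _+_; _*_)
open import Data.Product using (_,_; proj₁; proj₂)
open import Function.Bundles using (mk⇔)
open import Relation.Binary.PropositionalEquality using (refl; trans; cong; cong₂)

theorem8 : (p : ℕ) → Prime p → p ≢ 3 →
    (∃ (IsRepresentation p) ⇔ ∃ λ (k : ℤ) → + p ≡ + 6 * k + 1ℤ)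
    × (∃ (IsRepresentation p) → ∃! _≡_ (IsRepresentation p))
theorem8 p pp p≢3 = mk⇔ to from , unique!
  where
  to : ∃ (IsRepresentation p) → ∃ λ (k : ℤ) → + p ≡ + 6 * k + 1ℤ
  to (_ , rep) with representation⁻ rep
  ... | a , b , _ , _ , eq with prime-norm⇒≡1[6] pp p≢3 (a , b , eq)
  ...   | m , p≡6m+1 = + m , trans (cong +_ p≡6m+1) (pos-6*+1 m)

  from : (∃ λ (k : ℤ) → + p ≡ + 6 * k + 1ℤ) → ∃ (IsRepresentation p)
  from (k , eq) with pos≡6*+1⁻ k eq
  ... | m , p≡6m+1 with ∃-norm⇒∃-ordered (prime≡1[6]⇒norm m pp p≡6m+1)
  ...   | a , b , b≤a , p≡norm = (+ a , + b) , representation⁺ b≤a p≡norm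

  unique! : ∃ (IsRepresentation p) → ∃! _≡_ (IsRepresentation p)
  unique! (ab , rep) = ab , rep , λ {cd} rep′ → same rep rep′
    where
    same : ∀ {ab cd} → IsRepresentation p ab → IsRepresentation p cd → ab ≡ cd
    same rep rep′ with representation⁻ rep | representation⁻ rep′
    ... | a , b , (refl , refl) , b≤a , eab | c , d , (refl , refl) , d≤c , ecd
      = cong₂ (λ x y → + x , + y) (proj₁ a≡c,b≡d) (proj₂ a≡c,b≡d)
      where a≡c,b≡d = unique pp p≢3 b≤a d≤c eab ecd
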